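{- Let $C_n$ denote the cycle of order $n$ and $W_n$ the wheel obtained from $C_n$ by joining a new vertex to every vertex of $C_n$ ($n\geq 3$). Then: (a) $pvc(W_3)=0$ and $pvc(W_n)=1$ for all $n\geq 4$. (b) $pvc_2(W_3)=1$ and $pvc_2(W_n)=pvc(C_n)$ for all $n\geq 4$. (c) $pvc_3(W_3)=1$ and $pvc_3(W_n)=pvc_2(C_n)$ for all $n\geq 4$.
   Context: All graphs are simple, finite and undirected. Vertex-colorings are arbitrary (adjacent vertices may receive the same color). A path in a vertex-colored graph is a vertex-proper path if any two adjacent internal vertices of the path differ in color (the end-vertices of the path are not internal). A set of internally vertex-disjoint paths is called disjoint. A vertex-colored graph is proper vertex $k$-connected if any two distinct vertices are connected by $k$ (distinct) disjoint vertex-proper paths. For a $k$-connected graph $G$, $pvc_k(G)$ is the smallest number of colors required to make $G$ proper vertex $k$-connected; $pvc(G)=pvc_1(G)$. The value $0$ is allowed: it means that no vertex needs to be colored, where an uncolored path counts as vertex-proper exactly when it has no internal vertices. -}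

module Defs where

open import Data.Empty using (⊥)
open import Data.Fin using (Fin; zero; suc; toℕ)
open import Data.List using (List; []; _∷_; _∷ʳ_)
open import Data.List.Relation.Binary.Disjoint.Propositional using (Disjoint)
open import Data.List.Relation.Unary.Linked using (Linked)
open import Data.List.Relation.Unary.Unique.Propositional using (Unique)
open import Data.Nat using (ℕ; zero; suc; _≤_; z≤n; s≤s)
open import Data.Nat.Properties using (_≟_; 1+n≢n)
open import Data.Product using (Σ-syntax; _×_; _,_)
open import Data.Sum using (_⊎_; inj₁; inj₂; swap)
open import Data.Unit using (⊤; tt)
open import Function using (_on_)
open import Level using (0ℓ)
open import Relation.Binary using (Rel; Symmetric; Irreflexive; Decidable)
open import Relation.Binary.PropositionalEquality using (_≡_; _≢_; refl; sym)
open import Relation.Nullary using (¬_; Dec; yes; no)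
open import Relation.Nullary.Decidable using (_×-dec_; _⊎-dec_)

record Graph : Set₁ where
  field
    order      : ℕ
  Vertex : Set
  Vertex = Fin order
  field
    Adj        : Rel Vertex 0ℓ
    adj?       : Decidable Adj
    adj-sym    : Symmetric Adj
    adj-irrefl : Irreflexive _≡_ Adj

open Graph public using (order; Vertex; Adj; adj?; adj-sym; adj-irrefl)

Next : ∀ {n} → Rel (Fin n) 0ℓ
Next {n} i j = toℕ j ≡ suc (toℕ i) ⊎ (suc (toℕ i) ≡ n × toℕ j ≡ 0)

next? : ∀ {n} → Decidable (Next {n})
next? {n} i j = (toℕ j ≟ suc (toℕ i)) ⊎-dec ((suc (toℕ i) ≟ n) ×-dec (toℕ j ≟ 0))

next-irrefl : ∀ {n} → 3 ≤ n → (i : Fin n) → ¬ Next i i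
next-irrefl _                i       (inj₁ eq)       = 1+n≢n (sym eq)
next-irrefl (s≤s (s≤s _))    zero    (inj₂ (() , _))
next-irrefl _                (suc i) (inj₂ (_ , ()))

cycle : (n : ℕ) → 3 ≤ n → Graph
cycle n n≥3 = record
  { order      = n
  ; Adj        = λ i j → Next i j ⊎ Next j i
  ; adj?       = λ i j → next? i j ⊎-dec next? j i
  ; adj-sym    = swap
  ; adj-irrefl = λ { {i} refl (inj₁ p) → next-irrefl n≥3 i p
                   ; {i} refl (inj₂ p) → next-irrefl n≥3 i p }
  }

module _ (G : Graph) where

  ConeAdj : Rel (Fin (suc (order G))) 0ℓ
  ConeAdj zero    zero    = ⊥
  ConeAdj zero    (suc _) = ⊤
  ConeAdj (suc _) zero    = ⊤
  ConeAdj (suc i) (suc j) = Adj G i j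

  coneAdj? : Decidable ConeAdj
  coneAdj? zero    zero    = no λ ()
  coneAdj? zero    (suc _) = yes tt
  coneAdj? (suc _) zero    = yes tt
  coneAdj? (suc i) (suc j) = adj? G i j

  coneAdj-sym : Symmetric ConeAdj
  coneAdj-sym {zero}  {suc _} _ = tt
  coneAdj-sym {suc _} {zero}  _ = tt
  coneAdj-sym {suc i} {suc j} p = adj-sym G p

  coneAdj-irrefl : Irreflexive _≡_ ConeAdj
  coneAdj-irrefl {suc i} refl p = adj-irrefl G refl p

  -- The new vertex, joined to every vertex of G, is zero.
  cone : Graph
  cone = record
    { order      = suc (order G)
    ; Adj        = ConeAdj
    ; adj?       = coneAdj?
    ; adj-sym    = λ {x} {y} → coneAdj-sym {x} {y}
    ; adj-irrefl = λ {x} {y} → coneAdj-irrefl {x} {y}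
    }

wheel : (n : ℕ) → 3 ≤ n → Graph
wheel n n≥3 = cone (cycle n n≥3)

record Path (G : Graph) (u v : Vertex G) : Set where
  field
    internal : List (Vertex G)

  vertices : List (Vertex G)
  vertices = (u ∷ internal) ∷ʳ v

  field
    linked : Linked (Adj G) vertices
    unique : Unique vertices

open Path public using (internal; vertices; linked; unique)

-- With no colours available all vertices stay uncoloured, and only paths
-- without internal vertices count as vertex-proper.
Colouring : Graph → ℕ → Set
Colouring G zero    = ⊤
Colouring G (suc c) = Vertex G → Fin (suc c)

VertexProper : ∀ {G u v} (c : ℕ) → Colouring G c → Path G u v → Set
VertexProper zero    _   p = internal p ≡ []
VertexProper (suc c) col p = Linked (_≢_ on col) (internal p)

-- Paths are compared by their vertex sequences, since a `Path` also carries
-- proofs. Distinctness is not implied by disjointness: the path formed by a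
-- single edge has no internal vertices and is disjoint from itself.
record DisjointProperPaths (k : ℕ) (G : Graph) (c : ℕ) (col : Colouring G c)
                           (u v : Vertex G) : Set where
  field
    path     : Fin k → Path G u v
    proper   : ∀ i → VertexProper c col (path i)
    distinct : ∀ i j → i ≢ j → vertices (path i) ≢ vertices (path j)
    disjoint : ∀ i j → i ≢ j → Disjoint (internal (path i)) (internal (path j))

ProperVertexConnected : (k : ℕ) (G : Graph) (c : ℕ) → Colouring G c → Set
ProperVertexConnected k G c col =
  ∀ (u v : Vertex G) → u ≢ v → DisjointProperPaths k G c col u v

Suffices : ℕ → Graph → ℕ → Set
Suffices k G c = Σ[ col ∈ Colouring G c ] ProperVertexConnected k G c col

-- `pvc[ k ] G ≔ m` reads pvc_k(G) = m. k-connectedness is not a separate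
-- hypothesis: on at least two vertices it follows from `Suffices k G m`
-- (Menger), so other graphs have no value.
pvc[_]_≔_ : ℕ → Graph → ℕ → Set
pvc[ k ] G ≔ m = Suffices k G m × (∀ c → Suffices k G c → m ≤ c)

pvc_≔_ : Graph → ℕ → Set
pvc G ≔ m = pvc[ 1 ] G ≔ m

{-# OPTIONS --safe #-}
-- Of k + 1 disjoint paths between two vertices of G in the cone over G, at most
-- one passes through the hub, so k of them lie in G; conversely the path through
-- the hub can be added to k paths in G, and for the hub and a vertex v one uses
-- the edge and the paths of length two through k neighbours of v. Hence
-- pvc_{k+1}(W_n) = pvc_k(C_n) as soon as k ≤ 2 and the right-hand side is positive.
--
-- For n ≥ 4 the values are then read off from the two arcs joining two vertices of
-- C_n: pvc(C_n) is 1 if n ≤ 5 and 2 otherwise, and pvc_2(C_n) is the chromatic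
-- number of C_n, since both arcs between i and i + 3 are forced to be used and one
-- of them has the internal edge {i + 1, i + 2}.
module Submission where

open import Data.Empty using (⊥; ⊥-elim)
open import Data.Fin using (Fin; zero; suc; toℕ; punchIn; opposite; inject₁; inject≤; fromℕ)
import Data.Fin.Properties as Fin
open import Data.List using (List; []; _∷_; _∷ʳ_; [_]; map; applyUpTo; applyDownFrom)
open import Data.List.Membership.Propositional using (_∈_; _∉_)
open import Data.List.Membership.Propositional.Properties using (∈-map⁺; ∈-map⁻; ∈-applyUpTo⁻; ∈-applyDownFrom⁻; ∈-++⁺ʳ)
open import Data.List.Properties using (∷-injectiveˡ; ∷-injectiveʳ; ∷ʳ-injectiveˡ; map-++; map-injective; applyUpTo-∷ʳ; applyDownFrom-∷ʳ)
open import Data.List.Relation.Binary.Disjoint.Propositional using (Disjoint)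
open import Data.List.Relation.Unary.All as All using (All; []; _∷_)
open import Data.List.Relation.Unary.AllPairs using ([]; _∷_)
open import Data.List.Relation.Unary.Any using (here; there)
open import Data.List.Relation.Unary.Linked as Linked using (Linked; []; [-]; _∷_)
import Data.List.Relation.Unary.Linked.Properties as Linked
open import Data.List.Relation.Unary.Unique.Propositional using (Unique)
import Data.List.Relation.Unary.Unique.Propositional.Properties as Unique
open import Data.Nat using (ℕ; zero; suc; _+_; _∸_; _*_; _≤_; _<_; z≤n; s≤s; NonZero; >-nonZero)
open import Data.Nat.DivMod using (_/_; _%_; _mod_; m%n<n; m<n⇒m%n≡m; m≡m%n+[m/n]*n; n%n≡0; [m+n]%n≡m%n; %-distribˡ-+)
open import Data.Nat.Properties
open import Data.Product using (Σ-syntax; ∃-syntax; _×_; _,_; proj₁; proj₂)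
open import Data.Sum using (_⊎_; inj₁; inj₂; [_,_]′)
open import Data.Unit using (tt)
open import Function using (_on_; _∘_)
open import Function.Definitions using (Injective)
open import Relation.Binary.PropositionalEquality using (_≡_; _≢_; refl; sym; trans; cong; subst; module ≡-Reasoning)
open import Relation.Nullary using (¬_; yes; no)
open import Relation.Nullary.Decidable using (_⊎-dec_; from-yes)
open import Defs

-- Disjoint paths in an arbitrary graph and what they require of a colouring

Fin1-≡ : (a b : Fin 1) → a ≡ b
Fin1-≡ zero zero = refl

module _ {G : Graph} where

  vertices≡⇒internal≡ : ∀ {u v} (p q : Path G u v) → vertices p ≡ vertices q → internal p ≡ internal q
  vertices≡⇒internal≡ p q eq = ∷ʳ-injectiveˡ (internal p) (internal q) (∷-injectiveʳ eq)

  adj⇒≢ : ∀ {u v} → Adj G u v → u ≢ v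
  adj⇒≢ u~v u≡v = adj-irrefl G u≡v u~v

  edge : ∀ {u v} → Adj G u v → Path G u v
  edge u~v = record
    { internal = []
    ; linked   = u~v ∷ [-]
    ; unique   = (adj⇒≢ u~v ∷ []) ∷ [] ∷ []
    }

  hop : ∀ {u w v} → Adj G u w → Adj G w v → u ≢ v → Path G u v
  hop {w = w} u~w w~v u≢v = record
    { internal = [ w ]
    ; linked   = u~w ∷ w~v ∷ [-]
    ; unique   = (adj⇒≢ u~w ∷ u≢v ∷ []) ∷ (adj⇒≢ w~v ∷ []) ∷ [] ∷ []
    }

  onePath : ∀ {c col u v} (p : Path G u v) → VertexProper c col p → DisjointProperPaths 1 G c col u v
  onePath p proper = record
    { path     = λ _ → p
    ; proper   = λ _ → proper
    ; distinct = λ { zero zero 0≢0 → ⊥-elim (0≢0 refl) }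
    ; disjoint = λ { zero zero 0≢0 → ⊥-elim (0≢0 refl) }
    }

  twoPaths : ∀ {c col u v} (p q : Path G u v) → VertexProper c col p → VertexProper c col q →
             internal p ≢ internal q → Disjoint (internal p) (internal q) →
             DisjointProperPaths 2 G c col u v
  twoPaths p q p-proper q-proper p≢q p#q = record
    { path     = λ { zero → p ; (suc zero) → q }
    ; proper   = λ { zero → p-proper ; (suc zero) → q-proper }
    ; distinct = λ { zero       zero       i≢i → ⊥-elim (i≢i refl)
                   ; zero       (suc zero) _   → p≢q ∘ vertices≡⇒internal≡ p q
                   ; (suc zero) zero       _   → p≢q ∘ sym ∘ vertices≡⇒internal≡ q p
                   ; (suc zero) (suc zero) i≢i → ⊥-elim (i≢i refl) }
    ; disjoint = λ { zero       zero       i≢i → ⊥-elim (i≢i refl)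
                   ; zero       (suc zero) _   → p#q
                   ; (suc zero) zero       _   → λ (x∈q , x∈p) → p#q (x∈p , x∈q)
                   ; (suc zero) (suc zero) i≢i → ⊥-elim (i≢i refl) }
    }

  -- None of these paths has more than one internal vertex, so any colouring with at least one
  -- colour makes them proper. They serve the pairs formed by the hub of a cone and a rim vertex.
  adjacentPaths : ∀ {k u v} → Adj G u v → (w : Fin k → Vertex G) → Injective _≡_ _≡_ w →
                  (∀ i → Adj G u (w i)) → (∀ i → Adj G (w i) v) →
                  ∀ {c} (col : Colouring G (suc c)) → DisjointProperPaths (suc k) G (suc c) col u v
  adjacentPaths {k} {u} {v} u~v w w-inj u~w w~v {c} col = record
    { path     = path
    ; proper   = λ { zero → [] ; (suc i) → [-] }
    ; distinct = λ i j i≢j eq → internal-distinct i j i≢j (vertices≡⇒internal≡ (path i) (path j) eq)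
    ; disjoint = disjoint
    }
    where
    path : Fin (suc k) → Path G u v
    path zero    = edge u~v
    path (suc i) = hop (u~w i) (w~v i) (adj⇒≢ u~v)

    internal-distinct : ∀ i j → i ≢ j → internal (path i) ≢ internal (path j)
    internal-distinct zero    zero    i≢j _  = i≢j refl
    internal-distinct (suc i) (suc j) i≢j eq = i≢j (cong suc (w-inj (∷-injectiveˡ eq)))

    disjoint : ∀ i j → i ≢ j → Disjoint (internal (path i)) (internal (path j))
    disjoint (suc i) (suc j) i≢j (here refl , here eq) = i≢j (cong suc (w-inj eq))

  -- Consecutive internal vertices are adjacent, so a colouring that is proper in the usual sense
  -- suits every choice of paths.
  proper-colouring : ∀ {c} (col : Colouring G (suc c)) → (∀ {x y} → Adj G x y → col x ≢ col y) →
                     ∀ {u v} (p : Path G u v) → VertexProper (suc c) col p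
  proper-colouring col adj⇒col≢ p = Linked.map adj⇒col≢ (init (internal p) (Linked.tail (linked p)))
    where
    init : ∀ xs {y} → Linked (Adj G) (xs ∷ʳ y) → Linked (Adj G) xs
    init []           _        = []
    init (_ ∷ [])     _        = [-]
    init (_ ∷ x ∷ xs) (r ∷ rs) = r ∷ init (x ∷ xs) rs

  one-path-uncoloured : ∀ {u v} → DisjointProperPaths 1 G 0 tt u v → Adj G u v
  one-path-uncoloured D with path zero | proper zero
    where open DisjointProperPaths D
  ... | record { linked = u~v ∷ [-] } | refl = u~v

  -- Without colours both interiors would be empty and the two vertex sequences equal, which
  -- `distinct` forbids.
  two-paths-coloured : ∀ {k c col u v} → DisjointProperPaths (2 + k) G c col u v → 1 ≤ c
  two-paths-coloured {c = suc c} _ = s≤s z≤n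
  two-paths-coloured {c = zero} {u = u} {v} D =
    ⊥-elim (distinct zero (suc zero) (λ ())
      (cong (λ xs → (u ∷ xs) ∷ʳ v) (trans (proper zero) (sym (proper (suc zero))))))
    where open DisjointProperPaths D

  -- Two consecutive internal vertices would share the only colour, so the path has at most one
  -- internal vertex.
  one-path-monochromatic : ∀ {col u v} → DisjointProperPaths 1 G 1 col u v →
                           Adj G u v ⊎ ∃[ w ] (Adj G u w × Adj G w v)
  one-path-monochromatic {col} D = short (path zero) (proper zero)
    where
    open DisjointProperPaths D
    short : ∀ {u v} (p : Path G u v) → VertexProper 1 col p → Adj G u v ⊎ ∃[ w ] (Adj G u w × Adj G w v)
    short record { internal = [] ; linked = u~v ∷ [-] } _ = inj₁ u~v
    short record { internal = w ∷ [] ; linked = u~w ∷ w~v ∷ [-] } _ = inj₂ (w , u~w , w~v)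
    short record { internal = x ∷ y ∷ _ } (x≢y ∷ _) = ⊥-elim (x≢y (Fin1-≡ (col x) (col y)))

  -- A shared second vertex that is internal to both paths contradicts disjointness. If just one
  -- path is a single edge, that vertex is `v`, which the other path would visit twice; two single
  -- edges coincide.
  second-vertices-differ : ∀ {u v} (p q : Path G u v) → vertices p ≢ vertices q → Disjoint (internal p) (internal q) →
                           ∀ {x ys zs} → vertices p ≡ u ∷ x ∷ ys → vertices q ≢ u ∷ x ∷ zs
  second-vertices-differ record { internal = [] } record { internal = [] } p≢q _ refl refl = p≢q refl
  second-vertices-differ record { internal = [] } record { internal = _ ∷ xs ; unique = _ ∷ v∉ ∷ _ } _ _ refl refl =
    All.lookup v∉ (∈-++⁺ʳ xs (here refl)) refl
  second-vertices-differ record { internal = _ ∷ xs ; unique = _ ∷ v∉ ∷ _ } record { internal = [] } _ _ refl refl =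
    All.lookup v∉ (∈-++⁺ʳ xs (here refl)) refl
  second-vertices-differ record { internal = _ ∷ _ } record { internal = _ ∷ _ } _ p#q refl refl = p#q (here refl , here refl)

-- Alternating two-colourings and parity

alternate : ℕ → Fin 2
alternate zero    = zero
alternate (suc i) = opposite (alternate i)

alternate-≢ : ∀ i → alternate i ≢ alternate (suc i)
alternate-≢ i with alternate i
... | zero     = λ ()
... | suc zero = λ ()

≢-≢⇒≡ : {x y z : Fin 2} → x ≢ y → y ≢ z → x ≡ z
≢-≢⇒≡ {zero}     {zero}     {_}        x≢y _   = ⊥-elim (x≢y refl)
≢-≢⇒≡ {zero}     {suc zero} {zero}     _   _   = refl
≢-≢⇒≡ {zero}     {suc zero} {suc zero} _   y≢z = ⊥-elim (y≢z refl)
≢-≢⇒≡ {suc zero} {suc zero} {_}        x≢y _   = ⊥-elim (x≢y refl)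
≢-≢⇒≡ {suc zero} {zero}     {zero}     _   y≢z = ⊥-elim (y≢z refl)
≢-≢⇒≡ {suc zero} {zero}     {suc zero} _   _   = refl

-- Up to swapping the colours `f` is `alternate`, so it can return to `f 0` only after an even
-- number of steps. Evenness of `n` is expressed throughout as `alternate n ≡ zero`.
alternates : (f : ℕ → Fin 2) → (∀ i → f i ≢ f (suc i)) → ∀ n → f n ≡ f 0 → alternate n ≡ zero
alternates f f-≢ n fn≡f0 with in-phase n
  where
  in-phase : ∀ i → (f i ≡ f 0 × alternate i ≡ zero) ⊎ (f i ≢ f 0 × alternate i ≡ suc zero)
  in-phase zero    = inj₁ (refl , refl)
  in-phase (suc i) with in-phase i
  ... | inj₁ (fi≡f0 , eq) = inj₂ ((λ e → f-≢ i (trans fi≡f0 (sym e))) , cong opposite eq)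
  ... | inj₂ (fi≢f0 , eq) = inj₁ (≢-≢⇒≡ (f-≢ i ∘ sym) fi≢f0 , cong opposite eq)
... | inj₁ (_ , eq)    = eq
... | inj₂ (fn≢f0 , _) = ⊥-elim (fn≢f0 fn≡f0)


-- Transfer of disjoint paths between a graph and its cone

preimage : ∀ {n} (xs : List (Fin (suc n))) → zero ∉ xs → Σ[ ys ∈ List (Fin n) ] map suc ys ≡ xs
preimage []           _   = [] , refl
preimage (zero ∷ _)   0∉  = ⊥-elim (0∉ (here refl))
preimage (suc x ∷ xs) 0∉ with ys , refl ← preimage xs (0∉ ∘ there) = x ∷ ys , refl

zero∉map-suc : ∀ {n} (xs : List (Fin n)) → zero ∉ map {B = Fin (suc n)} suc xs
zero∉map-suc xs 0∈ with ∈-map⁻ suc 0∈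
... | _ , _ , ()

module _ {G : Graph} where

  vertices-map : ∀ (u v : Vertex G) xs → map suc ((u ∷ xs) ∷ʳ v) ≡ (suc u ∷ map suc xs) ∷ʳ suc v
  vertices-map u v xs = map-++ suc (u ∷ xs) [ v ]

  embed : ∀ {u v} → Path G u v → Path (cone G) (suc u) (suc v)
  embed {u} {v} p = record
    { internal = map suc (internal p)
    ; linked   = subst (Linked (Adj (cone G))) eq (Linked.map⁺ (linked p))
    ; unique   = subst Unique eq (Unique.map⁺ Fin.suc-injective (unique p))
    }
    where eq = vertices-map u v (internal p)

  -- The equation between the interiors is returned because properness, distinctness and
  -- disjointness are all transported along it.
  project : ∀ {u v} (p : Path (cone G) (suc u) (suc v)) → zero ∉ internal p →
            Σ[ q ∈ Path G u v ] map suc (internal q) ≡ internal p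
  project {u} {v} record { internal = xs ; linked = l ; unique = un } 0∉ with preimage xs 0∉
  ... | ys , refl = q , refl
    where
    eq = sym (vertices-map u v ys)
    q : Path G u v
    q = record
      { internal = ys
      ; linked   = Linked.map⁻ (subst (Linked (Adj (cone G))) eq l)
      ; unique   = Unique.map⁻ (subst Unique eq un)
      }

  rimColouring : ∀ c → Colouring (cone G) c → Colouring G c
  rimColouring zero    _   = tt
  rimColouring (suc c) col = col ∘ suc

  -- Any colour will do for the hub: the paths of `base⇒cone` in which it is internal have no other
  -- internal vertex.
  coneColouring : ∀ {c} → Colouring G (suc c) → Colouring (cone G) (suc c)
  coneColouring col zero    = zero
  coneColouring col (suc x) = col x

  project-proper : ∀ c (col : Colouring (cone G) c) {u v} (p : Path (cone G) (suc u) (suc v)) (q : Path G u v) →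
                   map suc (internal q) ≡ internal p →
                   VertexProper c col p → VertexProper c (rimColouring c col) q
  project-proper zero    col p q eq pr = map-injective Fin.suc-injective (trans eq pr)
  project-proper (suc c) col p q eq pr = Linked.map⁻ (subst (Linked (_≢_ on col)) (sym eq) pr)

  others-avoid-hub : ∀ {k c col u v} (D : DisjointProperPaths (suc k) (cone G) c col u v) →
             Σ[ i ∈ Fin (suc k) ] (∀ j → i ≢ j → zero ∉ internal (DisjointProperPaths.path D j))
  others-avoid-hub D with Fin.any? (λ i → zero ∈? internal (path i))
    where open DisjointProperPaths D
          open import Data.List.Membership.DecPropositional Fin._≟_ using (_∈?_)
  ... | yes (i , 0∈i) = i , λ j i≢j 0∈j → DisjointProperPaths.disjoint D i j i≢j (0∈i , 0∈j)
  -- A default index: when no path meets the hub, any one of them may be given up.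
  ... | no  none      = zero , λ j _ 0∈j → none (j , 0∈j)

  -- The number of colours is kept, so lower bounds for the base carry over to the cone.
  cone⇒base : ∀ {k c} → Suffices (suc k) (cone G) c → Suffices k G c
  cone⇒base {k} {c} (col , conn) = rimColouring c col , λ u v u≢v → rim u v (conn (suc u) (suc v) (u≢v ∘ Fin.suc-injective))
    where
    rim : ∀ u v → DisjointProperPaths (suc k) (cone G) c col (suc u) (suc v) →
          DisjointProperPaths k G c (rimColouring c col) u v
    rim u v D = record
      { path     = path′
      ; proper   = λ j → project-proper c col (path (ι j)) (path′ j) (path′-≡ j) (proper (ι j))
      ; distinct = λ i j i≢j eq → distinct (ι i) (ι j) (i≢j ∘ Fin.punchIn-injective hub i j) (begin
          (suc u ∷ internal (path (ι i))) ∷ʳ suc v          ≡⟨ cong (λ xs → (suc u ∷ xs) ∷ʳ suc v) (path′-≡ i) ⟨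
          (suc u ∷ map suc (internal (path′ i))) ∷ʳ suc v   ≡⟨ cong (λ xs → (suc u ∷ map suc xs) ∷ʳ suc v)
                                                               (vertices≡⇒internal≡ (path′ i) (path′ j) eq) ⟩
          (suc u ∷ map suc (internal (path′ j))) ∷ʳ suc v   ≡⟨ cong (λ xs → (suc u ∷ xs) ∷ʳ suc v) (path′-≡ j) ⟩
          (suc u ∷ internal (path (ι j))) ∷ʳ suc v          ∎)
      ; disjoint = λ i j i≢j (x∈i , x∈j) → disjoint (ι i) (ι j) (i≢j ∘ Fin.punchIn-injective hub i j)
          (subst (_ ∈_) (path′-≡ i) (∈-map⁺ suc x∈i) , subst (_ ∈_) (path′-≡ j) (∈-map⁺ suc x∈j))
      }
      where
      open DisjointProperPaths D
      open ≡-Reasoning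
      -- This is the index of the path given up, not a vertex; `ι` enumerates the other `k` indices.
      hub = proj₁ (others-avoid-hub D)
      ι = punchIn hub
      projected : ∀ j → Σ[ q ∈ Path G u v ] map suc (internal q) ≡ internal (path (ι j))
      projected j = project (path (ι j)) (proj₂ (others-avoid-hub D) (ι j) (Fin.punchInᵢ≢i hub j ∘ sym))
      path′ : Fin k → Path G u v
      path′ = proj₁ ∘ projected
      path′-≡ : ∀ j → map suc (internal (path′ j)) ≡ internal (path (ι j))
      path′-≡ = proj₂ ∘ projected

  -- The neighbours of `v` carry the detours between the hub and `v`. Two rim vertices keep their
  -- `k` paths in the base and gain the one through the hub.
  base⇒cone : ∀ {k c} → (∀ v → Σ[ w ∈ (Fin k → Vertex G) ] Injective _≡_ _≡_ w × (∀ i → Adj G v (w i))) →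
              Suffices k G (suc c) → Suffices (suc k) (cone G) (suc c)
  base⇒cone {k} {c} neighbours (col , conn) = col′ , connected
    where
    col′ = coneColouring col

    rim : ∀ u v → u ≢ v → DisjointProperPaths k G (suc c) col u v →
          DisjointProperPaths (suc k) (cone G) (suc c) col′ (suc u) (suc v)
    rim u v u≢v D = record
      { path     = path′
      ; proper   = λ { zero → [-] ; (suc i) → Linked.map⁺ (proper i) }
      ; distinct = distinct′
      ; disjoint = disjoint′
      }
      where
      open DisjointProperPaths D
      path′ : Fin (suc k) → Path (cone G) (suc u) (suc v)
      path′ zero    = hop tt tt (u≢v ∘ Fin.suc-injective)
      path′ (suc i) = embed (path i)

      distinct′ : ∀ i j → i ≢ j → vertices (path′ i) ≢ vertices (path′ j)
      distinct′ zero    zero    i≢j _  = i≢j refl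
      distinct′ zero    (suc j) i≢j eq =
        zero∉map-suc (internal (path j))
          (subst (zero {order G} ∈_) (vertices≡⇒internal≡ (path′ zero) (path′ (suc j)) eq) (here refl))
      distinct′ (suc i) zero    i≢j eq =
        zero∉map-suc (internal (path i))
          (subst (zero {order G} ∈_) (sym (vertices≡⇒internal≡ (path′ (suc i)) (path′ zero) eq)) (here refl))
      distinct′ (suc i) (suc j) i≢j eq = distinct i j (i≢j ∘ cong suc)
        (cong (λ xs → (u ∷ xs) ∷ʳ v)
          (map-injective Fin.suc-injective (vertices≡⇒internal≡ (path′ (suc i)) (path′ (suc j)) eq)))

      disjoint′ : ∀ i j → i ≢ j → Disjoint (internal (path′ i)) (internal (path′ j))
      disjoint′ zero    zero    i≢j _                = i≢j refl
      disjoint′ zero    (suc j) i≢j (here refl , x∈) = zero∉map-suc (internal (path j)) x∈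
      disjoint′ (suc i) zero    i≢j (x∈ , here refl) = zero∉map-suc (internal (path i)) x∈
      disjoint′ (suc i) (suc j) i≢j (x∈i , x∈j)
        with y , y∈i , refl ← ∈-map⁻ suc x∈i | z , z∈j , refl ← ∈-map⁻ suc x∈j =
        disjoint i j (i≢j ∘ cong suc) (y∈i , z∈j)

    connected : ProperVertexConnected (suc k) (cone G) (suc c) col′
    connected zero    zero    0≢0 = ⊥-elim (0≢0 refl)
    connected zero    (suc v) _   with w , w-inj , v~w ← neighbours v =
      adjacentPaths tt (suc ∘ w) (w-inj ∘ Fin.suc-injective) (λ _ → tt) (λ i → adj-sym G (v~w i)) col′
    connected (suc v) zero    _   with w , w-inj , v~w ← neighbours v =
      adjacentPaths tt (suc ∘ w) (w-inj ∘ Fin.suc-injective) v~w (λ _ → tt) col′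
    connected (suc u) (suc v) u≢v = rim u v (u≢v ∘ cong suc) (conn u v (u≢v ∘ cong suc))

-- Positions on a cycle modulo its order

module Cycle {n : ℕ} (n≥3 : 3 ≤ n) where

  C : Graph
  C = cycle n n≥3

  instance
    n≢0 : NonZero n
    n≢0 = >-nonZero (≤-trans (s≤s z≤n) n≥3)

  -- Vertices are addressed by arbitrary natural numbers, so an arc passing from `n - 1` to `0` is
  -- still an interval of positions.
  at : ℕ → Vertex C
  at i = i mod n

  toℕ-at : ∀ i → toℕ (at i) ≡ i % n
  toℕ-at i = Fin.toℕ-fromℕ< _

  at-% : ∀ i (u : Fin n) → i % n ≡ toℕ u → at i ≡ u
  at-% i u eq = Fin.toℕ-injective (trans (toℕ-at i) eq)

  at-toℕ : ∀ u → at (toℕ u) ≡ u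
  at-toℕ u = at-% (toℕ u) u (m<n⇒m%n≡m (Fin.toℕ<n u))

  at-periodic : ∀ i → at (n + i) ≡ at i
  at-periodic i = at-% (n + i) (at i) (begin
    (n + i) % n  ≡⟨ cong (_% n) (+-comm n i) ⟩
    (i + n) % n  ≡⟨ [m+n]%n≡m%n i n ⟩
    i % n        ≡⟨ toℕ-at i ⟨
    toℕ (at i)   ∎)
    where open ≡-Reasoning

  suc-% : ∀ i → suc i % n ≡ suc (i % n) % n
  suc-% i = trans (%-distribˡ-+ 1 i n) (cong (λ z → (z + i % n) % n) (m<n⇒m%n≡m (<⇒≤ n≥3)))

  next-at : ∀ i → Next (at i) (at (suc i))
  next-at i rewrite toℕ-at i | toℕ-at (suc i) | suc-% i with m≤n⇒m<n∨m≡n (m%n<n i n)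
  ... | inj₁ 1+r<n = inj₁ (m<n⇒m%n≡m 1+r<n)
  ... | inj₂ 1+r≡n = inj₂ (1+r≡n , trans (cong (_% n) 1+r≡n) (n%n≡0 n))

  -- With equal remainders only the quotients matter: a larger quotient for `j` gives `i + n ≤ j`,
  -- and otherwise `j ≤ i`.
  at-injective : ∀ {i j} → i < j → j < i + n → at i ≢ at j
  at-injective {i} {j} i<j j<i+n eq = [ ascending , descending ]′ (≤-total (suc (i / n)) (j / n))
    where
    i%n≡j%n : i % n ≡ j % n
    i%n≡j%n = trans (sym (toℕ-at i)) (trans (cong toℕ eq) (toℕ-at j))

    ascending : suc (i / n) ≤ j / n → ⊥
    ascending q<q′ = <-irrefl refl (begin-strict
      j                            <⟨ j<i+n ⟩
      i + n                        ≡⟨ cong (_+ n) (m≡m%n+[m/n]*n i n) ⟩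
      i % n + i / n * n + n        ≡⟨ +-assoc (i % n) (i / n * n) n ⟩
      i % n + (i / n * n + n)      ≡⟨ cong (i % n +_) (+-comm (i / n * n) n) ⟩
      i % n + suc (i / n) * n      ≤⟨ +-mono-≤ (≤-reflexive i%n≡j%n) (*-monoˡ-≤ n q<q′) ⟩
      j % n + j / n * n            ≡⟨ m≡m%n+[m/n]*n j n ⟨
      j                            ∎)
      where open ≤-Reasoning

    descending : j / n ≤ suc (i / n) → ⊥
    descending q′≤1+q with m≤n⇒m<n∨m≡n q′≤1+q
    ... | inj₂ q′≡1+q = ascending (≤-reflexive (sym q′≡1+q))
    ... | inj₁ (s≤s q′≤q) = <-irrefl refl (begin-strict
      i                   <⟨ i<j ⟩
      j                   ≡⟨ m≡m%n+[m/n]*n j n ⟩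
      j % n + j / n * n   ≤⟨ +-mono-≤ (≤-reflexive (sym i%n≡j%n)) (*-monoˡ-≤ n q′≤q) ⟩
      i % n + i / n * n   ≡⟨ m≡m%n+[m/n]*n i n ⟨
      i                   ∎)
      where open ≤-Reasoning

  window : ∀ x {i j} → i < j → j < n → at (i + x) ≢ at (j + x)
  window x {i} {j} i<j j<n = at-injective (+-monoˡ-< x i<j) (begin-strict
    j + x        <⟨ +-monoˡ-< x j<n ⟩
    n + x        ≡⟨ +-comm n x ⟩
    x + n        ≤⟨ +-monoˡ-≤ n (m≤n+m x i) ⟩
    i + x + n    ∎)
    where open ≤-Reasoning

  -- The witness is the forward distance from `u` to `v`, equal to `n - u + v` when the way up
  -- passes from `n - 1` to `0`.
  at-surjective : ∀ (u v : Fin n) → ∃[ t ] t < n × at (t + toℕ u) ≡ v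
  at-surjective u v with ≤-total (toℕ u) (toℕ v)
  ... | inj₁ u≤v = toℕ v ∸ toℕ u , ≤-<-trans (m∸n≤m _ (toℕ u)) (Fin.toℕ<n v) ,
                   trans (cong at (m∸n+n≡m u≤v)) (at-toℕ v)
  ... | inj₂ v≤u with m≤n⇒m<n∨m≡n v≤u
  ...   | inj₂ v≡u = 0 , ≤-trans (s≤s z≤n) n≥3 , trans (cong at (sym v≡u)) (at-toℕ v)
  ...   | inj₁ v<u = n ∸ toℕ u + toℕ v , t<n , reached
    where
    n-u+u≡n = m∸n+n≡m (<⇒≤ (Fin.toℕ<n u))

    t<n : n ∸ toℕ u + toℕ v < n
    t<n = <-≤-trans (+-monoʳ-< (n ∸ toℕ u) v<u) (≤-reflexive n-u+u≡n)

    reached : at (n ∸ toℕ u + toℕ v + toℕ u) ≡ v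
    reached = begin
      at (n ∸ toℕ u + toℕ v + toℕ u)     ≡⟨ cong at (+-assoc (n ∸ toℕ u) (toℕ v) (toℕ u)) ⟩
      at (n ∸ toℕ u + (toℕ v + toℕ u))   ≡⟨ cong (λ z → at (n ∸ toℕ u + z)) (+-comm (toℕ v) (toℕ u)) ⟩
      at (n ∸ toℕ u + (toℕ u + toℕ v))   ≡⟨ cong at (+-assoc (n ∸ toℕ u) (toℕ u) (toℕ v)) ⟨
      at (n ∸ toℕ u + toℕ u + toℕ v)     ≡⟨ cong (λ z → at (z + toℕ v)) n-u+u≡n ⟩
      at (n + toℕ v)                     ≡⟨ at-periodic (toℕ v) ⟩
      at (toℕ v)                         ≡⟨ at-toℕ v ⟩
      v                                  ∎
      where open ≡-Reasoning

  -- The two arcs between two vertices of a cycle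

  -- With its ends the path is a run of `2 + m` consecutive positions. Linkedness is `next-at` along
  -- this run, and uniqueness holds because the run fits into one turn.
  ascent : ∀ {u v} x m → 2 + m ≤ n → u ≡ at x → v ≡ at (suc m + x) → Path C u v
  ascent {u} {v} x m 2+m≤n u≡ v≡ = record
    { internal = applyUpTo (λ i → at (suc i + x)) m
    ; linked   = subst (Linked (Adj C)) (sym eq) (Linked.applyUpTo⁺₁ _ (2 + m) (λ {i} _ → inj₁ (next-at (i + x))))
    ; unique   = subst Unique (sym eq) (Unique.applyUpTo⁺₁ _ (2 + m) (λ i<j j< → window x i<j (<-≤-trans j< 2+m≤n)))
    }
    where
    eq : (u ∷ applyUpTo (λ i → at (suc i + x)) m) ∷ʳ v ≡ applyUpTo (λ i → at (i + x)) (2 + m)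
    eq rewrite u≡ | v≡ = applyUpTo-∷ʳ (λ i → at (i + x)) (suc m)

  descent : ∀ {u v} y l → 2 + l ≤ n → u ≡ at (suc l + y) → v ≡ at y → Path C u v
  descent {u} {v} y l 2+l≤n u≡ v≡ = record
    { internal = applyDownFrom (λ i → at (suc i + y)) l
    ; linked   = subst (Linked (Adj C)) (sym eq) (Linked.applyDownFrom⁺₁ _ (2 + l) (λ {i} _ → inj₂ (next-at (i + y))))
    ; unique   = subst Unique (sym eq) (Unique.applyDownFrom⁺₁ _ (2 + l) (λ j<i i< → window y j<i (<-≤-trans i< 2+l≤n) ∘ sym))
    }
    where
    eq : (u ∷ applyDownFrom (λ i → at (suc i + y)) l) ∷ʳ v ≡ applyDownFrom (λ i → at (i + y)) (2 + l)
    eq rewrite u≡ | v≡ = applyDownFrom-∷ʳ (λ i → at (i + y)) (suc l)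

  -- ↑ follows the cycle upwards from u to v and ↓ downwards, with m and l internal vertices.
  record Arcs (u v : Vertex C) : Set where
    field
      m l     : ℕ
      length≡ : suc m + suc l ≡ n
      v≡      : v ≡ at (suc m + toℕ u)

    origin : ℕ
    origin = toℕ u

    u≡ : u ≡ at origin
    u≡ = sym (at-toℕ u)

    2+m≤n : 2 + m ≤ n
    2+m≤n = begin
      2 + m           ≡⟨ +-comm 1 (suc m) ⟩
      suc m + 1       ≤⟨ +-monoʳ-≤ (suc m) (s≤s z≤n) ⟩
      suc m + suc l   ≡⟨ length≡ ⟩
      n               ∎
      where open ≤-Reasoning

    2+l≤n : 2 + l ≤ n
    2+l≤n = ≤-trans (+-monoˡ-≤ (suc l) (s≤s z≤n)) (≤-reflexive length≡)

    length-from : ∀ i → suc l + (suc m + i) ≡ n + i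
    length-from i = trans (sym (+-assoc (suc l) (suc m) i)) (cong (_+ i) (trans (+-comm (suc l) (suc m)) length≡))

    -- The downward arc starts from `u` seen one full turn later, at position `n + origin`, so that
    -- it descends without subtraction.
    wrapped : u ≡ at (suc l + (suc m + origin))
    wrapped = trans u≡ (trans (sym (at-periodic origin)) (cong at (sym (length-from origin))))

    ↑ ↓ : Path C u v
    ↑ = ascent origin m 2+m≤n u≡ v≡
    ↓ = descent (suc m + origin) l 2+l≤n wrapped v≡

    -- The interiors occupy the offsets `1` to `m` and `m + 2` to `n - 1` from `origin`, which are
    -- separate intervals within one turn.
    ↑#↓ : Disjoint (internal ↑) (internal ↓)
    ↑#↓ (x∈↑ , x∈↓)
      with i , i<m , eqᵢ ← ∈-applyUpTo⁻ _ x∈↑ | j , j<l , eqⱼ ← ∈-applyDownFrom⁻ _ x∈↓ =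
      at-injective
        (+-mono-<-≤ {suc i} {suc j + suc m} (≤-trans (s≤s i<m) (m≤n+m (suc m) (suc j))) (≤-refl {origin}))
        (begin-strict
          suc j + suc m + origin     <⟨ +-monoˡ-< origin (+-monoˡ-< (suc m) (s≤s j<l)) ⟩
          suc l + suc m + origin     ≡⟨ +-assoc (suc l) (suc m) origin ⟩
          suc l + (suc m + origin)   ≡⟨ length-from origin ⟩
          n + origin                 ≡⟨ +-comm n origin ⟩
          origin + n                 ≤⟨ +-monoˡ-≤ n (m≤n+m origin (suc i)) ⟩
          suc i + origin + n         ∎)
        (trans (sym eqᵢ) (trans eqⱼ (cong at (sym (+-assoc (suc j) (suc m) origin)))))
      where open ≤-Reasoning

    -- Equal disjoint interiors are both empty, which would make the order 2.
    ↑≢↓ : internal ↑ ≢ internal ↓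
    ↑≢↓ eq with m | l | length≡ | ↑#↓ | eq
    ... | zero  | zero  | 2≡n | _   | _  = <-irrefl 2≡n n≥3
    ... | zero  | suc _ | _   | _   | ()
    ... | suc _ | _     | _   | dis | e  = dis (here refl , subst (_ ∈_) e (here refl))

  -- The forward distance from `u` to `v` is positive since they differ, and less than `n`; hence it
  -- is some `suc m`, and the rest of the turn is some `suc l`.
  arcs : ∀ u v → u ≢ v → Arcs u v
  arcs u v u≢v with at-surjective u v
  ... | zero  , _    , at≡v = ⊥-elim (u≢v (trans (sym (at-toℕ u)) at≡v))
  ... | suc m , m<n , at≡v with m≤n⇒∃[o]m+o≡n m<n
  ...   | l , 2+m+l≡n = record
    { m       = m
    ; l       = l
    ; length≡ = trans (+-suc (suc m) l) 2+m+l≡n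
    ; v≡      = sym at≡v
    }

  module _ {c} {col : Colouring C c} where

    oneArc : (∀ {u v} (A : Arcs u v) → VertexProper c col (Arcs.↑ A) ⊎ VertexProper c col (Arcs.↓ A)) →
             ProperVertexConnected 1 C c col
    oneArc proper u v u≢v = [ onePath ↑ , onePath ↓ ]′ (proper A)
      where
      A = arcs u v u≢v
      open Arcs A

    bothArcs : (∀ {u v} (A : Arcs u v) → VertexProper c col (Arcs.↑ A) × VertexProper c col (Arcs.↓ A)) →
               ProperVertexConnected 2 C c col
    bothArcs proper u v u≢v = twoPaths ↑ ↓ (proj₁ (proper A)) (proj₂ (proper A)) ↑≢↓ ↑#↓
      where
      A = arcs u v u≢v
      open Arcs A

  neighbours : ∀ v → Σ[ w ∈ (Fin 2 → Vertex C) ] Injective _≡_ _≡_ w × (∀ i → Adj C v (w i))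
  neighbours v = w , (λ {i} {j} → w-inj i j) , v~w
    where
    w : Fin 2 → Vertex C
    w zero       = at (suc (toℕ v))
    -- The predecessor of `v`, reached by `n - 1` forward steps.
    w (suc zero) = at (n ∸ 1 + toℕ v)

    distinct : w zero ≢ w (suc zero)
    distinct = window (toℕ v) {1} {n ∸ 1} (∸-monoˡ-≤ 1 n≥3) (≤-reflexive (m+[n∸m]≡n (<⇒≤ (<⇒≤ n≥3))))

    w-inj : ∀ i j → w i ≡ w j → i ≡ j
    w-inj zero       zero       _  = refl
    w-inj zero       (suc zero) eq = ⊥-elim (distinct eq)
    w-inj (suc zero) zero       eq = ⊥-elim (distinct (sym eq))
    w-inj (suc zero) (suc zero) _  = refl

    v~w : ∀ i → Adj C v (w i)
    v~w zero       = inj₁ (subst (λ z → Next z (w zero)) (at-toℕ v) (next-at (toℕ v)))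
    v~w (suc zero) = inj₂ (subst (Next (w (suc zero)))
      (trans (cong (λ z → at (z + toℕ v)) (m+[n∸m]≡n (<⇒≤ (<⇒≤ n≥3)))) (trans (at-periodic (toℕ v)) (at-toℕ v)))
      (next-at (n ∸ 1 + toℕ v)))

  -- Colourings of cycles: upper bounds

  oneColour : Colouring C 1
  oneColour _ = zero

  ↑-short : ∀ {u v} (A : Arcs u v) → Arcs.m A ≤ 1 → VertexProper 1 oneColour (Arcs.↑ A)
  ↑-short A m≤1 with Arcs.m A | m≤1
  ... | zero     | _ = []
  ... | suc zero | _ = [-]
  ... | suc (suc _) | s≤s ()

  ↓-short : ∀ {u v} (A : Arcs u v) → Arcs.l A ≤ 1 → VertexProper 1 oneColour (Arcs.↓ A)
  ↓-short A l≤1 with Arcs.l A | l≤1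
  ... | zero     | _ = []
  ... | suc zero | _ = [-]
  ... | suc (suc _) | s≤s ()

  -- If both arcs had two internal vertices, the cycle would have order at least 6.
  order≤5⇒suffices₁ : n ≤ 5 → Suffices 1 C 1
  order≤5⇒suffices₁ n≤5 = oneColour , oneArc shorter
    where
    shorter : ∀ {u v} (A : Arcs u v) → VertexProper 1 oneColour (Arcs.↑ A) ⊎ VertexProper 1 oneColour (Arcs.↓ A)
    shorter A with ≤-<-connex (Arcs.m A) 1 | ≤-<-connex (Arcs.l A) 1
    ... | inj₁ m≤1 | _        = inj₁ (↑-short A m≤1)
    ... | inj₂ _   | inj₁ l≤1 = inj₂ (↓-short A l≤1)
    ... | inj₂ 2≤m | inj₂ 2≤l =
      ⊥-elim (<-irrefl refl (≤-trans (+-mono-≤ (s≤s 2≤m) (s≤s 2≤l)) (≤-trans (≤-reflexive (Arcs.length≡ A)) n≤5)))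

  triangle-suffices₂ : n ≡ 3 → Suffices 2 C 1
  triangle-suffices₂ n≡3 = oneColour , bothArcs λ A → let open Arcs A in
    ↑-short A (≤-pred (≤-pred (≤-trans 2+m≤n (≤-reflexive n≡3)))) ,
    ↓-short A (≤-pred (≤-pred (≤-trans 2+l≤n (≤-reflexive n≡3))))

  last : Vertex C
  last = at (n ∸ 1)

  suc-last : suc (toℕ last) ≡ n
  suc-last = begin
    suc (toℕ last)      ≡⟨ cong suc (toℕ-at (n ∸ 1)) ⟩
    suc ((n ∸ 1) % n)   ≡⟨ cong suc (m<n⇒m%n≡m (≤-reflexive (suc-pred n))) ⟩
    suc (n ∸ 1)         ≡⟨ suc-pred n ⟩
    n                   ∎
    where open ≡-Reasoning

  alternating : Colouring C 2
  alternating v = alternate (toℕ v)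

  -- Parity changes along every edge except possibly the closing one, which starts at `last`.
  alternating-at : ∀ i → at i ≢ last → alternating (at i) ≢ alternating (at (suc i))
  alternating-at i i≢last with next-at i
  ... | inj₁ eq       = λ same → alternate-≢ (toℕ (at i)) (trans same (cong alternate eq))
  ... | inj₂ (eq , _) = λ _ → i≢last (Fin.toℕ-injective (suc-injective (trans eq (sym suc-last))))

  -- The alternating colouring can fail only at the edge from n - 1 to 0, which one of the two arcs avoids.
  suffices₁ : Suffices 1 C 2
  suffices₁ = alternating , oneArc avoiding-last
    where
    avoiding-last : ∀ {u v} (A : Arcs u v) → VertexProper 2 alternating (Arcs.↑ A) ⊎ VertexProper 2 alternating (Arcs.↓ A)
    avoiding-last {u} A with at-surjective u last
    -- Here `t` is the offset of `last` from `u`. Internal edges of `↑` start at offsets below `m`,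
    -- those of `↓` have their lower end at an offset above `m`, so comparing `m` with `t` selects
    -- the arc.
    ... | t , t<n , at≡last with ≤-<-connex (Arcs.m A) t
    ...   | inj₁ m≤t = inj₁ (Linked.applyUpTo⁺₁ _ m λ {i} 1+i<m →
              alternating-at (suc i + toℕ u) λ eq → window (toℕ u) (<-≤-trans 1+i<m m≤t) t<n (trans eq (sym at≡last)))
              where open Arcs A
    ...   | inj₂ t<m = inj₂ (Linked.applyDownFrom⁺₁ _ l λ {i} 1+i<l →
              alternating-at (suc i + (suc m + toℕ u)) (λ eq →
                window (toℕ u) {t} {suc i + suc m}
                  (<-≤-trans t<m (≤-trans (n≤1+n m) (m≤n+m (suc m) (suc i))))
                  (<-≤-trans (+-monoˡ-< (suc m) 1+i<l) (≤-trans (+-monoˡ-≤ (suc m) (n≤1+n l))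
                    (≤-reflexive (trans (+-comm (suc l) (suc m)) length≡))))
                  (trans at≡last (trans (sym eq) (cong at (sym (+-assoc (suc i) (suc m) (toℕ u))))))) ∘ sym)
              where open Arcs A

  proper⇒suffices₂ : ∀ {c} (col : Colouring C (suc c)) → (∀ {x y} → Next x y → col x ≢ col y) → Suffices 2 C (suc c)
  proper⇒suffices₂ col next⇒≢ = col , bothArcs λ A →
    proper-colouring col adj⇒col≢ (Arcs.↑ A) , proper-colouring col adj⇒col≢ (Arcs.↓ A)
    where
    adj⇒col≢ : ∀ {x y} → Adj C x y → col x ≢ col y
    adj⇒col≢ (inj₁ x→y) = next⇒≢ x→y
    adj⇒col≢ (inj₂ y→x) = next⇒≢ y→x ∘ sym

  even⇒suffices₂ : alternate n ≡ zero → Suffices 2 C 2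
  even⇒suffices₂ n-even = proper⇒suffices₂ alternating next⇒≢
    where
    next⇒≢ : ∀ {x y} → Next x y → alternating x ≢ alternating y
    next⇒≢ {x} (inj₁ y≡1+x) same = alternate-≢ (toℕ x) (trans same (cong alternate y≡1+x))
    -- As `n` is even, `0` has the colour that alternation would assign to `n`, so the closing edge
    -- behaves like the others.
    next⇒≢ {x} (inj₂ (1+x≡n , y≡0)) same =
      alternate-≢ (toℕ x) (trans same (trans (cong alternate y≡0) (sym (trans (cong alternate 1+x≡n) n-even))))

  -- The third colour is given to `n - 1` alone; the remaining vertices form a path, on which two
  -- alternating colours are proper.
  suffices₂ : Suffices 2 C 3
  suffices₂ = proper⇒suffices₂ col next⇒≢
    where
    col : Colouring C 3
    col x with suc (toℕ x) ≟ n
    ... | yes _ = fromℕ 2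
    ... | no  _ = inject₁ (alternate (toℕ x))

    next⇒≢ : ∀ {x y} → Next x y → col x ≢ col y
    next⇒≢ {x} {y} x→y with suc (toℕ x) ≟ n | suc (toℕ y) ≟ n | x→y
    ... | yes x-last | yes y-last | _ = λ _ →
      adj⇒≢ {G = C} {x} {y} (inj₁ x→y) (Fin.toℕ-injective (suc-injective (trans x-last (sym y-last))))
    ... | yes _ | no _  | _ = Fin.fromℕ≢inject₁
    ... | no _  | yes _ | _ = Fin.fromℕ≢inject₁ ∘ sym
    ... | no _  | no _  | inj₁ y≡1+x = λ same →
      alternate-≢ (toℕ x) (trans (Fin.inject₁-injective same) (cong alternate y≡1+x))
    ... | no x≢last | no _ | inj₂ (x-last , _) = ⊥-elim (x≢last x-last)

  -- Lower bounds for cycles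

  next-functional : ∀ {x y z : Fin n} → Next x y → Next x z → y ≡ z
  next-functional (inj₁ p) (inj₁ q) = Fin.toℕ-injective (trans p (sym q))
  next-functional {y = y} (inj₁ p) (inj₂ (q , _)) = ⊥-elim (<-irrefl (trans p q) (Fin.toℕ<n y))
  next-functional {z = z} (inj₂ (p , _)) (inj₁ q) = ⊥-elim (<-irrefl (trans q p) (Fin.toℕ<n z))
  next-functional (inj₂ (_ , p)) (inj₂ (_ , q)) = Fin.toℕ-injective (trans p (sym q))

  next-injective : ∀ {x y z : Fin n} → Next x z → Next y z → x ≡ y
  next-injective (inj₁ p) (inj₁ q) = Fin.toℕ-injective (suc-injective (trans (sym p) q))
  next-injective (inj₁ p) (inj₂ (_ , q)) with () ← trans (sym p) q
  next-injective (inj₂ (_ , p)) (inj₁ q) with () ← trans (sym q) p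
  next-injective (inj₂ (p , _)) (inj₂ (q , _)) = Fin.toℕ-injective (suc-injective (trans p (sym q)))

  module _ {a b c d : Vertex C} (a→b : Next a b) (b→c : Next b c) (c→d : Next c d) (a≢d : a ≢ d) (b≢d : b ≢ d) where

    -- The second vertex of a path from a to d is a neighbour of a: either b, whence the
    -- path must continue to c, or the other neighbour x.
    through-or-back : (p : Path C a d) →
      (∃[ ys ] internal p ≡ b ∷ c ∷ ys) ⊎ (∃[ x ] ∃[ ys ] Next x a × vertices p ≡ a ∷ x ∷ ys)
    through-or-back record { internal = [] ; linked = inj₁ a→d ∷ _ } = ⊥-elim (b≢d (next-functional a→b a→d))
    through-or-back record { internal = [] ; linked = inj₂ d→a ∷ _ } = inj₂ (d , _ , d→a , refl)
    through-or-back record { internal = x ∷ _ ; linked = inj₂ x→a ∷ _ } = inj₂ (x , _ , x→a , refl)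
    through-or-back record { internal = x ∷ xs ; linked = inj₁ a→x ∷ l ; unique = (_ ∷ a∉) ∷ _ }
      with refl ← next-functional a→b a→x = inj₁ (onwards xs l a∉)
      where
      onwards : ∀ xs → Linked (Adj C) (b ∷ (xs ∷ʳ d)) → All (a ≢_) (xs ∷ʳ d) → ∃[ ys ] b ∷ xs ≡ b ∷ c ∷ ys
      onwards []       (inj₁ b→d ∷ _) _ = ⊥-elim (next-irrefl n≥3 d (subst (λ z → Next z d) (next-functional b→c b→d) c→d))
      onwards []       (inj₂ d→b ∷ _) _ = ⊥-elim (a≢d (next-injective a→b d→b))
      onwards (y ∷ ys) (inj₁ b→y ∷ _) _ with refl ← next-functional b→c b→y = ys , refl
      onwards (y ∷ ys) (inj₂ y→b ∷ _) (a≢y ∷ _) = ⊥-elim (a≢y (next-injective a→b y→b))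

    -- By `second-vertices-differ` the two paths cannot both leave `a` backwards, so one of them has
    -- `b` and `c` as its first internal vertices.
    middle-edge : ∀ {k} {col : Colouring C (suc k)} → DisjointProperPaths 2 C (suc k) col a d → col b ≢ col c
    middle-edge {k} {col} D with through-or-back (path zero) | through-or-back (path (suc zero))
      where open DisjointProperPaths D
    ... | inj₁ (_ , eq) | _ = Linked.head (subst (Linked (_≢_ on col)) eq (DisjointProperPaths.proper D zero))
    ... | inj₂ _ | inj₁ (_ , eq) = Linked.head (subst (Linked (_≢_ on col)) eq (DisjointProperPaths.proper D (suc zero)))
    ... | inj₂ (x , _ , x→a , eq) | inj₂ (y , _ , y→a , eq′) with refl ← next-injective x→a y→a =
      ⊥-elim (second-vertices-differ (path zero) (path (suc zero)) (distinct zero (suc zero) λ ())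
        (disjoint zero (suc zero) λ ()) eq eq′)
      where open DisjointProperPaths D

  module _ (n≥4 : 4 ≤ n) where

    -- The paths between `at i` and `at (3 + i)` force the edge in the middle; over all `i` this
    -- makes the colouring proper.
    forced-≢ : ∀ {c} ((col , _) : Suffices 2 C (suc c)) → ∀ i → col (at (suc i)) ≢ col (at (suc (suc i)))
    forced-≢ (col , conn) i =
      middle-edge (next-at i) (next-at (1 + i)) (next-at (2 + i)) a≢d (window i (s≤s (s≤s z≤n)) n≥4)
        (conn (at i) (at (3 + i)) a≢d)
      where
      a≢d : at i ≢ at (3 + i)
      a≢d = window i (s≤s z≤n) n≥4

    suffices₂⇒≥2 : ∀ c → Suffices 2 C c → 2 ≤ c
    suffices₂⇒≥2 zero (col , conn) with () ← two-paths-coloured (conn (at 0) (at 1) (window 0 (s≤s z≤n) (<⇒≤ n≥3)))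
    suffices₂⇒≥2 (suc zero) S@(col , _) = ⊥-elim (forced-≢ S 0 (Fin1-≡ _ _))
    suffices₂⇒≥2 (suc (suc c)) _ = s≤s (s≤s z≤n)

    -- Read once around the cycle, the colours alternate and return to the first one. The reading
    -- starts at position 1, where the edges of `forced-≢` begin.
    suffices₂-2⇒even : Suffices 2 C 2 → alternate n ≡ zero
    suffices₂-2⇒even S@(col , _) = alternates (λ i → col (at (suc i))) (forced-≢ S) n
      (cong col (trans (cong at (+-comm 1 n)) (at-periodic 1)))

    -- The value has the form `suc m` because `wheel-pvc` transfers positive values.
    pvc₂ : ∃[ m ] pvc[ 2 ] C ≔ suc m
    pvc₂ with alternate n Fin.≟ zero
    ... | yes n-even = 1 , even⇒suffices₂ n-even , suffices₂⇒≥2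
    ... | no  n-odd  = 2 , suffices₂ , λ c S → ≤∧≢⇒< (suffices₂⇒≥2 c S) λ { refl → n-odd (suffices₂-2⇒even S) }

    at0≁at2 : ¬ Adj C (at 0) (at 2)
    at0≁at2 (inj₁ 0→2) = window 0 {1} {2} (s≤s (s≤s z≤n)) n≥3 (next-functional (next-at 0) 0→2)
    at0≁at2 (inj₂ 2→0) = window 0 {0} {3} (s≤s z≤n) n≥4 (next-functional 2→0 (next-at 2))

    suffices₁⇒≥1 : ∀ c → Suffices 1 C c → 1 ≤ c
    suffices₁⇒≥1 zero (_ , conn) =
      ⊥-elim (at0≁at2 (one-path-uncoloured (conn (at 0) (at 2) (window 0 (s≤s z≤n) n≥3))))
    suffices₁⇒≥1 (suc c) _ = s≤s z≤n

  -- Positions 0 and 3 are at distance 3, so every path between them has two consecutive internal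
  -- vertices.
  suffices₁⇒≥2 : 6 ≤ n → ∀ c → Suffices 1 C c → 2 ≤ c
  suffices₁⇒≥2 n≥6 = λ where
      zero          (_ , conn) → ⊥-elim (not-adjacent (one-path-uncoloured (conn (at 0) (at 3) at0≢at3)))
      (suc zero)    (_ , conn) → ⊥-elim ([ not-adjacent , no-common-neighbour ]′
                                   (one-path-monochromatic (conn (at 0) (at 3) at0≢at3)))
      (suc (suc c)) _          → s≤s (s≤s z≤n)
    where
    at-≢ : ∀ {i j} → i < j → j < 6 → at i ≢ at j
    at-≢ i<j j<6 = at-injective i<j (<-≤-trans j<6 (≤-trans n≥6 (m≤n+m n _)))

    at0≢at3 = at-≢ {0} {3} (s≤s z≤n) (s≤s (s≤s (s≤s (s≤s z≤n))))

    not-adjacent : ¬ Adj C (at 0) (at 3)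
    not-adjacent (inj₁ 0→3) = at-≢ {1} {3} (s≤s (s≤s z≤n)) (s≤s (s≤s (s≤s (s≤s z≤n)))) (next-functional (next-at 0) 0→3)
    not-adjacent (inj₂ 3→0) = at-≢ {0} {4} (s≤s z≤n) (s≤s (s≤s (s≤s (s≤s (s≤s z≤n))))) (next-functional 3→0 (next-at 3))

    no-common-neighbour : ¬ (∃[ w ] (Adj C (at 0) w × Adj C w (at 3)))
    no-common-neighbour (w , inj₁ 0→w , inj₁ w→3) =
      at-≢ {1} {2} ≤-refl (s≤s (s≤s (s≤s z≤n))) (trans (next-functional (next-at 0) 0→w) (next-injective w→3 (next-at 2)))
    no-common-neighbour (w , inj₁ 0→w , inj₂ 3→w) = at0≢at3 (next-injective 0→w 3→w)
    no-common-neighbour (w , inj₂ w→0 , inj₁ w→3) = at0≢at3 (next-functional w→0 w→3)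
    -- Here `w` is position 4, so positions 0 and 5 would both be its successor; they differ since
    -- `n` is at least 6.
    no-common-neighbour (w , inj₂ w→0 , inj₂ 3→w) =
      at-≢ {0} {5} (s≤s z≤n) ≤-refl
        (next-functional w→0 (subst (λ z → Next z (at 5)) (next-functional (next-at 3) 3→w) (next-at 4)))

  pvc₁ : 4 ≤ n → ∃[ m ] pvc C ≔ suc m
  pvc₁ n≥4 with ≤-<-connex n 5
  ... | inj₁ n≤5 = 0 , order≤5⇒suffices₁ n≤5 , suffices₁⇒≥1 n≥4
  ... | inj₂ n≥6 = 1 , suffices₁ , suffices₁⇒≥2 n≥6

  -- Wheels as cones over cycles

  -- A vertex of the cycle offers two neighbours for detours to the hub, whence `k ≤ 2`.
  wheel-suffices : ∀ {k c} → k ≤ 2 → Suffices k C (suc c) → Suffices (suc k) (wheel n n≥3) (suc c)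
  wheel-suffices k≤2 = base⇒cone λ v → let w , w-inj , v~w = neighbours v in
    (λ i → w (inject≤ i k≤2)) , (λ eq → Fin.inject≤-injective k≤2 k≤2 _ _ (w-inj eq)) , (λ i → v~w (inject≤ i k≤2))

  wheel-pvc : ∀ {k m} → k ≤ 2 → pvc[ k ] C ≔ suc m → pvc[ suc k ] (wheel n n≥3) ≔ suc m
  wheel-pvc k≤2 (S , minimal) = wheel-suffices k≤2 S , λ c → minimal c ∘ cone⇒base

  -- The upper bound is the cone construction for `k = 0`, where the rim supplies no paths. The
  -- lower bound comes from two rim vertices that are not adjacent.
  wheel-pvc₁ : 4 ≤ n → pvc (wheel n n≥3) ≔ 1
  wheel-pvc₁ n≥4 = wheel-suffices z≤n no-paths , λ
    { zero    (_ , conn) → ⊥-elim (at0≁at2 n≥4 (one-path-uncoloured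
                             (conn (suc (at 0)) (suc (at 2)) (window 0 (s≤s z≤n) n≥3 ∘ Fin.suc-injective))))
    ; (suc c) _          → s≤s z≤n }
    where
    no-paths : Suffices 0 C 1
    no-paths = oneColour , λ _ _ _ → record { path = λ () ; proper = λ () ; distinct = λ () ; disjoint = λ () }

complete-pvc₁ : ∀ {G} → (∀ u v → u ≢ v → Adj G u v) → pvc G ≔ 0
complete-pvc₁ complete = (tt , λ u v u≢v → onePath (edge (complete u v u≢v)) refl) , λ _ _ → z≤n

wheel₃-complete : ∀ u v → u ≢ v → Adj (wheel 3 ≤-refl) u v
wheel₃-complete u v u≢v = [ ⊥-elim ∘ u≢v , (λ u~v → u~v) ]′
  -- Adjacency is decidable, so the sixteen pairs of vertices are checked by computation.
  (from-yes (Fin.all? λ u → Fin.all? λ v → (u Fin.≟ v) ⊎-dec adj? (wheel 3 ≤-refl) u v) u v)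

theorem3 : ( (pvc (wheel 3 ≤-refl) ≔ 0)
    × (∀ n (n≥4 : 4 ≤ n) → pvc (wheel n (<⇒≤ n≥4)) ≔ 1) )
    × ( (pvc[ 2 ] (wheel 3 ≤-refl) ≔ 1)
    × (∀ n (n≥4 : 4 ≤ n) → ∃[ m ]
    ((pvc[ 2 ] (wheel n (<⇒≤ n≥4)) ≔ m) × (pvc (cycle n (<⇒≤ n≥4)) ≔ m))) )
    × ( (pvc[ 3 ] (wheel 3 ≤-refl) ≔ 1)
    × (∀ n (n≥4 : 4 ≤ n) → ∃[ m ]
    ((pvc[ 3 ] (wheel n (<⇒≤ n≥4)) ≔ m) × (pvc[ 2 ] (cycle n (<⇒≤ n≥4)) ≔ m))) )
theorem3 =
    (complete-pvc₁ wheel₃-complete , λ n n≥4 → wheel-pvc₁ (<⇒≤ n≥4) n≥4)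
  -- One path in the triangle needs no colour, so its value is 0 and `wheel-pvc` does not apply. One
  -- colour is forced in the wheel because two distinct paths cannot both be single edges.
  , ( (wheel-suffices ≤-refl (s≤s z≤n) (order≤5⇒suffices₁ ≤-refl (s≤s (s≤s (s≤s z≤n)))) , at-least-1)
    , λ n n≥4 → let m , value = pvc₁ (<⇒≤ n≥4) n≥4 in
        suc m , wheel-pvc (<⇒≤ n≥4) (s≤s z≤n) value , value )
  , ( (wheel-suffices ≤-refl ≤-refl (triangle-suffices₂ ≤-refl refl) , at-least-1)
    , λ n n≥4 → let m , value = pvc₂ (<⇒≤ n≥4) n≥4 in
        suc m , wheel-pvc (<⇒≤ n≥4) ≤-refl value , value )
  where
  open Cycle
  at-least-1 : ∀ {k} c → Suffices (2 + k) (wheel 3 ≤-refl) c → 1 ≤ c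
  at-least-1 c (_ , conn) = two-paths-coloured (conn zero (suc zero) λ ())
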